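{- If $G=(V,E)$ is a digraph such that $\widetilde G$ is locally finite, then $G\in\mathfrak{In}_2\text{ - }\mathfrak{Out}_2$.
   Context: Digraphs $G=(V,E)$, $E\subseteq V\times V$, may be infinite (of any cardinality). The undirected complement of $G$ is the undirected graph $\widetilde G=(V,\widetilde E)$ where, for distinct $x,y\in V$, $\{x,y\}\in\widetilde E$ iff $(x,y)\notin E$ and $(y,x)\notin E$. An undirected graph is locally finite if every vertex has finite degree. For $W\subseteq V$, $G[W]=(W,E\cap (W\times W))$ is the induced subgraph. A set $A\subseteq V$ is independent if there is no edge (in either direction) of $G$ between two distinct elements of $A$. For $n\in\mathbb N$ and $A\subseteq V$, $\mathrm{Out}^G_n(A)$ (resp. $\mathrm{In}^G_n(A)$) is the set of all $v\in V$ such that there is a directed path of length at most $n$ from some point of $A$ to $v$ (resp. from $v$ to some point of $A$); length $0$ is allowed. $G\in\mathfrak{Out}_n$ (resp. $G\in\mathfrak{In}_n$) iff there is an independent $A\subseteq V$ with $V=\mathrm{Out}^G_n(A)$ (resp. $V=\mathrm{In}^G_n(A)$). $G\in\mathfrak{In}_n\text{ - }\mathfrak{Out}_k$ iff there is a partition $(V_1,V_2)$ of $V$ (parts may be empty) with $G[V_1]\in\mathfrak{In}_n$ and $G[V_2]\in\mathfrak{Out}_k$. -}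

module Defs where

open import Data.Fin.Base using (Fin; zero; suc; inject₁; fromℕ)
import Data.List.Membership.Propositional as List
open import Data.Nat.Base using (ℕ; suc; _≤_)
open import Data.Product.Base using (Σ; ∃-syntax; _×_; _,_)
open import Data.Refinement using (Refinement-syntax; value)
open import Function.Base using (_on_; _∘_)
open import Function.Bundles using (_⇔_)
open import Function.Definitions using (Injective)
open import Level using (Level; _⊔_)
open import Relation.Binary.Core using (Rel)
open import Relation.Binary.Definitions using (Symmetric; Irreflexive)
open import Relation.Binary.PropositionalEquality using (_≡_; _≢_; sym)
open import Relation.Nullary.Negation using (¬_)
open import Relation.Unary using (Pred; _∈_; _∪_; _⊥_; Universal)

private
  variable
    a p v e : Level

record Digraph (v e : Level) : Set (Level.suc (v ⊔ e)) where
  field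
    V : Set v
    E : Rel V e

record UndirectedGraph (v e : Level) : Set (Level.suc (v ⊔ e)) where
  field
    V      : Set v
    Adj    : Rel V e
    symm   : Symmetric Adj
    irrefl : Irreflexive _≡_ Adj

Finite : {A : Set a} → Pred A p → Set (a ⊔ p)
Finite {A = A} P = ∃[ xs ] (∀ (x : A) → x ∈ P ⇔ x List.∈ xs)

LocallyFinite : UndirectedGraph v e → Set (v ⊔ e)
LocallyFinite H = ∀ x → Finite (Adj x)
  where open UndirectedGraph H

undirectedComplement : Digraph v e → UndirectedGraph v (v ⊔ e)
undirectedComplement G = record
  { V      = V
  ; Adj    = λ x y → x ≢ y × ¬ E x y × ¬ E y x
  ; symm   = λ (x≢y , ¬xy , ¬yx) → x≢y ∘ sym , ¬yx , ¬xy
  ; irrefl = λ x≡y (x≢y , _) → x≢y x≡y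
  }
  where open Digraph G

-- The membership proof in a vertex of the induced subgraph is irrelevant, so
-- two such vertices are equal as soon as they are equal as vertices of G.
induced : (G : Digraph v e) → Pred (Digraph.V G) p → Digraph (v ⊔ p) e
induced G W = record
  { V = [ x ∈ V ∣ W x ]
  ; E = E on value
  }
  where open Digraph G

module _ (G : Digraph v e) where
  open Digraph G

  Independent : Pred V p → Set (v ⊔ e ⊔ p)
  Independent A = ∀ {x y} → x ∈ A → y ∈ A → x ≢ y → ¬ E x y × ¬ E y x

  record DirectedPath (x y : V) (k : ℕ) : Set (v ⊔ e) where
    field
      vertex   : Fin (suc k) → V
      distinct : Injective _≡_ _≡_ vertex
      start    : vertex zero ≡ x
      end      : vertex (fromℕ k) ≡ y
      edge     : ∀ i → E (vertex (inject₁ i)) (vertex (suc i))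

  Out : ℕ → Pred V p → Pred V (v ⊔ e ⊔ p)
  Out n A y = ∃[ x ] (x ∈ A × ∃[ k ] (k ≤ n × DirectedPath x y k))

  In : ℕ → Pred V p → Pred V (v ⊔ e ⊔ p)
  In n A y = ∃[ x ] (x ∈ A × ∃[ k ] (k ≤ n × DirectedPath y x k))

InClass : ℕ → Pred (Digraph v e) (Level.suc (v ⊔ e))
InClass {v} {e} n G =
  Σ (Pred (Digraph.V G) (v ⊔ e)) λ A → Independent G A × Universal (In G n A)

OutClass : ℕ → Pred (Digraph v e) (Level.suc (v ⊔ e))
OutClass {v} {e} n G =
  Σ (Pred (Digraph.V G) (v ⊔ e)) λ A → Independent G A × Universal (Out G n A)

InOutClass : ℕ → ℕ → Pred (Digraph v e) (Level.suc (v ⊔ e))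
InOutClass {v} {e} n k G =
  Σ (Pred V (v ⊔ e)) λ V₁ → Σ (Pred V (v ⊔ e)) λ V₂ →
    (Universal (V₁ ∪ V₂) × V₁ ⊥ V₂) ×
    InClass n (induced G V₁) × OutClass k (induced G V₂)
  where open Digraph G

{-# OPTIONS --safe #-}
-- Independent sets of G are cliques of the complement, so every vertex lies in
-- a finite maximal independent set A.  If A is not itself a quasi-kernel, take
-- x not reached from A in two steps.  No out-neighbour of A has an edge to x;
-- hence x dominates all of them except those in a finite set F of vertices
-- non-adjacent to x.  By Chvátal and Lovász F has a quasi-kernel K, and K ∪ {x}
-- is an independent quasi-kernel of {x} ∪ (N⁺(A) ∖ A).  By maximality each
-- remaining vertex is in A or has an edge to A.
module Submission where

open import Defs
open import Axiom.ExcludedMiddle using (ExcludedMiddle)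
import Data.Empty.Polymorphic as ⊥ₚ
open import Data.Fin.Base using (zero; suc)
open import Data.Irrelevant using ([_])
open import Data.List.Base using (List; []; _∷_)
import Data.List.Membership.Propositional as List
open import Data.List.Relation.Unary.Any using (here; there)
open import Data.Nat.Base using (z≤n; s≤s)
open import Data.Product.Base using (Σ; ∃-syntax; _×_; _,_; proj₁; proj₂)
open import Data.Refinement using (value; _,_)
open import Data.Refinement.Properties using (value-injective) renaming (_≟_ to ≡-dec)
open import Data.Sum.Base using (_⊎_; inj₁; inj₂)
import Data.Unit.Polymorphic as ⊤ₚ
open import Data.Vec.Base using ([]; _∷_; lookup)
open import Function.Base using (_∘_; id)
open import Function.Bundles using (Equivalence)
open import Level using (Level; _⊔_; Lift; lift; lower)
open import Relation.Binary.Definitions using (DecidableEquality; Decidable)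
open import Relation.Binary.PropositionalEquality using (_≡_; _≢_; refl; sym)
open import Relation.Nullary.Decidable using (Dec; yes; no; map′; recompute; decidable-stable)
open import Relation.Nullary.Negation using (¬_; contradiction)
open import Relation.Unary using (Pred; _∈_; _∉_; _⊆_; _∪_; _∩_; ∁; Universal)

-- Short paths and two-step walks in a digraph.

module _ {v e : Level} (G : Digraph v e) where
  open Digraph G

  path₀ : ∀ x → DirectedPath G x x 0
  path₀ x = record
    { vertex   = λ _ → x
    ; distinct = λ { {zero} {zero} _ → refl }
    ; start    = refl
    ; end      = refl
    ; edge     = λ ()
    }

  path₁ : ∀ {x y} → x ≢ y → E x y → DirectedPath G x y 1
  path₁ {x} {y} x≢y xy = record
    { vertex   = lookup (x ∷ y ∷ [])
    ; distinct = λ { {zero}     {zero}     _  → refl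
                   ; {zero}     {suc zero} eq → contradiction eq x≢y
                   ; {suc zero} {zero}     eq → contradiction (sym eq) x≢y
                   ; {suc zero} {suc zero} _  → refl }
    ; start    = refl
    ; end      = refl
    ; edge     = λ { zero → xy }
    }

  path₂ : ∀ {x y z} → x ≢ y → x ≢ z → y ≢ z → E x y → E y z → DirectedPath G x z 2
  path₂ {x} {y} {z} x≢y x≢z y≢z xy yz = record
    { vertex   = lookup (x ∷ y ∷ z ∷ [])
    ; distinct = λ
      { {zero}           {zero}           _  → refl
      ; {zero}           {suc zero}       eq → contradiction eq x≢y
      ; {zero}           {suc (suc zero)} eq → contradiction eq x≢z
      ; {suc zero}       {zero}           eq → contradiction (sym eq) x≢y
      ; {suc zero}       {suc zero}       _  → refl
      ; {suc zero}       {suc (suc zero)} eq → contradiction eq y≢z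
      ; {suc (suc zero)} {zero}           eq → contradiction (sym eq) x≢z
      ; {suc (suc zero)} {suc zero}       eq → contradiction (sym eq) y≢z
      ; {suc (suc zero)} {suc (suc zero)} _  → refl }
    ; start    = refl
    ; end      = refl
    ; edge     = λ { zero → xy ; (suc zero) → yz }
    }

  module _ (_≟_ : DecidableEquality V) {p} {A : Pred V p} where

    out₁ : ∀ {x y} → x ∈ A → E x y → Out G 2 A y
    out₁ {x} {y} x∈A xy with x ≟ y
    ... | yes refl = x , x∈A , 0 , z≤n , path₀ x
    ... | no  x≢y  = x , x∈A , 1 , s≤s z≤n , path₁ x≢y xy

    -- Loops are allowed and a path must have distinct vertices, so a walk of two edges need not be
    -- a path; each coincidence among its vertices leaves a shorter path.
    out₂ : ∀ {x y z} → x ∈ A → E x y → E y z → Out G 2 A z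
    out₂ {x} {y} {z} x∈A xy yz with x ≟ y | x ≟ z | y ≟ z
    ... | _        | yes refl | _        = x , x∈A , 0 , z≤n , path₀ x
    ... | yes refl | no _     | _        = out₁ x∈A yz
    ... | no _     | no _     | yes refl = out₁ x∈A xy
    ... | no x≢y   | no x≢z   | no y≢z   =
      x , x∈A , 2 , s≤s (s≤s z≤n) , path₂ x≢y x≢z y≢z xy yz

    in₁ : ∀ {x y} → x ∈ A → E y x → In G 2 A y
    in₁ {x} {y} x∈A yx with y ≟ x
    ... | yes refl = x , x∈A , 0 , z≤n , path₀ x
    ... | no  y≢x  = x , x∈A , 1 , s≤s z≤n , path₁ y≢x yx

  _─_ : V → V → Set e
  x ─ y = E x y ⊎ E y x

  -- Walks replace paths here, so no distinctness has to be tracked. Only the middle vertex is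
  -- confined to `W`; the ends are placed in `W` by whoever uses the relation.
  Within₂ : ∀ {p q} → Pred V p → Pred V q → Pred V _
  Within₂ W A y =
    y ∈ A ⊎ (∃[ x ] (x ∈ A × E x y)) ⊎ (∃[ x ] ∃[ z ] (x ∈ A × z ∈ W × E x z × E z y))

  Within₂-mono : ∀ {p q r s} {W : Pred V p} {W′ : Pred V q} {A : Pred V r} {A′ : Pred V s} →
    W ⊆ W′ → A ⊆ A′ → Within₂ W A ⊆ Within₂ W′ A′
  Within₂-mono W⊆ A⊆ (inj₁ y∈A)                   = inj₁ (A⊆ y∈A)
  Within₂-mono W⊆ A⊆ (inj₂ (inj₁ (x , x∈A , xy))) = inj₂ (inj₁ (x , A⊆ x∈A , xy))
  Within₂-mono W⊆ A⊆ (inj₂ (inj₂ (x , z , x∈A , z∈W , xz , zy))) =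
    inj₂ (inj₂ (x , z , A⊆ x∈A , W⊆ z∈W , xz , zy))

  insert-independent : ∀ {p q} {A : Pred V p} {B : Pred V q} {x : V} → Independent G A →
    (∀ {y} → y ∈ A → ¬ E x y × ¬ E y x) → (∀ {y} → y ∈ B → y ≡ x ⊎ y ∈ A) → Independent G B
  insert-independent {A = A} {x = x} indA nonadj B⊆ a∈B b∈B = go (B⊆ a∈B) (B⊆ b∈B)
    where
    go : ∀ {a b} → a ≡ x ⊎ a ∈ A → b ≡ x ⊎ b ∈ A → a ≢ b → ¬ E a b × ¬ E b a
    go (inj₁ refl) (inj₁ refl) a≢b = contradiction refl a≢b
    go (inj₁ refl) (inj₂ b∈A)  _   = nonadj b∈A
    go (inj₂ a∈A)  (inj₁ refl) _   = let na , nb = nonadj a∈A in nb , na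
    go (inj₂ a∈A)  (inj₂ b∈A)  a≢b = indA a∈A b∈A a≢b

module _ {v e : Level} (em : ExcludedMiddle (v ⊔ e)) (G : Digraph v e) where
  open Digraph G

  private
    ℓ : Level
    ℓ = v ⊔ e

    _≟_ : DecidableEquality V
    x ≟ y = map′ lower lift (em {Lift e (x ≡ y)})

    E? : Decidable E
    E? x y = map′ lower lift (em {Lift v (E x y)})

    NonAdj : V → Pred V ℓ
    NonAdj = UndirectedGraph.Adj (undirectedComplement G)

    -- The membership proof stored in a vertex is irrelevant; excluded middle decides membership,
    -- which makes a usable proof recoverable.
    member : ∀ {W : Pred V ℓ} (y : Digraph.V (induced G W)) → value y ∈ W
    member (y , [ y∈W ]) = recompute em y∈W

  -- From walks in `G` to the classes of induced subgraphs.

  independent-induced : ∀ {W A : Pred V ℓ} → Independent G A →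
    Independent (induced G W) (λ y → value y ∈ A)
  independent-induced indA x∈A y∈A x≢y = indA x∈A y∈A (x≢y ∘ value-injective)

  -- Source, middle vertex and target all lie in `W`, so the walk survives in the induced subgraph.
  outClass : ∀ {W A : Pred V ℓ} → A ⊆ W → Independent G A → W ⊆ Within₂ G W A →
    OutClass 2 (induced G W)
  outClass {W} {A} A⊆W indA reach =
    (λ y → value y ∈ A) , independent-induced {W} {A} indA , λ y → go y (reach (member y))
    where
    go : ∀ y → Within₂ G W A (value y) → Out (induced G W) 2 (λ y → value y ∈ A) y
    go y (inj₁ y∈A) = y , y∈A , 0 , z≤n , path₀ (induced G W) y
    go y (inj₂ (inj₁ (x , x∈A , xy))) =
      out₁ (induced G W) (≡-dec _≟_) {x = x , [ A⊆W x∈A ]} x∈A xy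
    go y (inj₂ (inj₂ (x , z , x∈A , z∈W , xz , zy))) =
      out₂ (induced G W) (≡-dec _≟_) {x = x , [ A⊆W x∈A ]} {y = z , [ z∈W ]} x∈A xz zy

  -- The hypothesis asks for a single edge into `A`, which is exactly what maximality of an
  -- independent set supplies.
  inClass : ∀ {W A : Pred V ℓ} → A ⊆ W → Independent G A →
    (∀ {y} → y ∈ W → y ∈ A ⊎ ∃[ x ] (x ∈ A × E y x)) → InClass 2 (induced G W)
  inClass {W} {A} A⊆W indA reach =
    (λ y → value y ∈ A) , independent-induced {W} {A} indA , λ y → go y (reach (member y))
    where
    go : ∀ y → value y ∈ A ⊎ ∃[ x ] (x ∈ A × E (value y) x) →
      In (induced G W) 2 (λ y → value y ∈ A) y
    go y (inj₁ y∈A)            = y , y∈A , 0 , z≤n , path₀ (induced G W) y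
    go y (inj₂ (x , x∈A , yx)) = in₁ (induced G W) (≡-dec _≟_) {x = x , [ A⊆W x∈A ]} x∈A yx

  -- Greedy constructions along a finite list.

  -- Greedy choice: the head is taken if it lies in `P`, and the recursion then continues among its
  -- non-neighbours. Shrinking `P` instead of the list keeps the recursion structural.
  finite-maximalIndependent : ∀ (xs : List V) (P : Pred V ℓ) → Σ (Pred V ℓ) λ A →
    A ⊆ P × Independent G A ×
    (∀ {y} → y List.∈ xs → y ∈ P → y ∈ A ⊎ ∃[ a ] (a ∈ A × _─_ G a y))
  finite-maximalIndependent [] P = (λ _ → ⊥ₚ.⊥) , (λ ()) , (λ ()) , λ ()
  finite-maximalIndependent (x ∷ xs) P with em {x ∈ P}
  ... | no x∉P =
    let A , A⊆P , indA , max = finite-maximalIndependent xs P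
    in A , A⊆P , indA ,
       λ { (here refl) y∈P → contradiction y∈P x∉P ; (there y∈xs) → max y∈xs }
  ... | yes x∈P = A′ , A′⊆P , insert-independent G indA (proj₂ ∘ proj₂ ∘ A⊆) id , max′
    where
    rec  = finite-maximalIndependent xs (P ∩ NonAdj x)
    A    = proj₁ rec
    A⊆   = proj₁ (proj₂ rec)
    indA = proj₁ (proj₂ (proj₂ rec))
    max  = proj₂ (proj₂ (proj₂ rec))
    A′ : Pred V ℓ
    A′ y = y ≡ x ⊎ y ∈ A
    A′⊆P : A′ ⊆ P
    A′⊆P (inj₁ refl) = x∈P
    A′⊆P (inj₂ y∈A)  = proj₁ (A⊆ y∈A)
    max′ : ∀ {y} → y List.∈ (x ∷ xs) → y ∈ P → y ∈ A′ ⊎ ∃[ a ] (a ∈ A′ × _─_ G a y)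
    max′ (here refl) _ = inj₁ (inj₁ refl)
    max′ {y} (there y∈xs) y∈P with x ≟ y | E? x y | E? y x
    ... | yes refl | _      | _      = inj₁ (inj₁ refl)
    ... | no _     | yes xy | _      = inj₂ (x , inj₁ refl , inj₁ xy)
    ... | no _     | no _   | yes yx = inj₂ (x , inj₁ refl , inj₂ yx)
    ... | no x≢y   | no ¬xy | no ¬yx with max y∈xs (y∈P , x≢y , ¬xy , ¬yx)
    ...   | inj₁ y∈A            = inj₁ (inj₂ y∈A)
    ...   | inj₂ (a , a∈A , ay) = inj₂ (a , inj₂ a∈A , ay)

  -- Induction of Chvátal and Lovász: set aside `x` and its out-neighbours and take a quasi-kernel
  -- `A` of what remains. If `A` has an edge to `x`, it reaches the out-neighbours of `x` in two
  -- steps; otherwise `x` is non-adjacent to `A` and can be added.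
  finite-quasiKernel : ∀ (xs : List V) (P : Pred V ℓ) → Σ (Pred V ℓ) λ A →
    A ⊆ P × Independent G A × (∀ {y} → y List.∈ xs → y ∈ P → Within₂ G P A y)
  finite-quasiKernel [] P = (λ _ → ⊥ₚ.⊥) , (λ ()) , (λ ()) , λ ()
  finite-quasiKernel (x ∷ xs) P with em {x ∈ P}
  ... | no x∉P =
    let A , A⊆P , indA , reach = finite-quasiKernel xs P
    in A , A⊆P , indA ,
       λ { (here refl) y∈P → contradiction y∈P x∉P ; (there y∈xs) → reach y∈xs }
  ... | yes x∈P = extend (em {∃[ a ] (a ∈ A × E a x)})
    where
    Q : Pred V ℓ
    Q y = y ∈ P × x ≢ y × ¬ E x y
    rec   = finite-quasiKernel xs Q
    A     = proj₁ rec
    A⊆Q   = proj₁ (proj₂ rec)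
    indA  = proj₁ (proj₂ (proj₂ rec))
    reach = proj₂ (proj₂ (proj₂ rec))

    extend : Dec (∃[ a ] (a ∈ A × E a x)) → Σ (Pred V ℓ) λ B →
      B ⊆ P × Independent G B × (∀ {y} → y List.∈ (x ∷ xs) → y ∈ P → Within₂ G P B y)
    extend (yes (a , a∈A , ax)) = A , proj₁ ∘ A⊆Q , indA , reach′
      where
      reach′ : ∀ {y} → y List.∈ (x ∷ xs) → y ∈ P → Within₂ G P A y
      reach′ (here refl) _ = inj₂ (inj₁ (a , a∈A , ax))
      reach′ {y} (there y∈xs) y∈P with x ≟ y | E? x y
      ... | yes refl | _      = inj₂ (inj₁ (a , a∈A , ax))
      ... | no _     | yes xy = inj₂ (inj₂ (a , x , a∈A , x∈P , ax , xy))
      ... | no x≢y   | no ¬xy = Within₂-mono G proj₁ id (reach y∈xs (y∈P , x≢y , ¬xy))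
    extend (no ¬ax) = B , B⊆P , insert-independent G indA nonadj id , reach′
      where
      B : Pred V ℓ
      B y = y ≡ x ⊎ y ∈ A
      B⊆P : B ⊆ P
      B⊆P (inj₁ refl) = x∈P
      B⊆P (inj₂ y∈A)  = proj₁ (A⊆Q y∈A)
      nonadj : ∀ {y} → y ∈ A → ¬ E x y × ¬ E y x
      -- Edges from `x` into `A` are excluded by `Q`, edges from `A` to `x` by the present case.
      nonadj y∈A = proj₂ (proj₂ (A⊆Q y∈A)) , λ yx → ¬ax (_ , y∈A , yx)
      reach′ : ∀ {y} → y List.∈ (x ∷ xs) → y ∈ P → Within₂ G P B y
      reach′ (here refl) _ = inj₁ (inj₁ refl)
      reach′ {y} (there y∈xs) y∈P with x ≟ y | E? x y
      ... | yes refl | _      = inj₁ (inj₁ refl)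
      ... | no _     | yes xy = inj₂ (inj₁ (x , inj₁ refl , xy))
      ... | no x≢y   | no ¬xy = Within₂-mono G proj₁ inj₂ (reach y∈xs (y∈P , x≢y , ¬xy))

  -- Digraphs with locally finite complement.

  module _ (locallyFinite : LocallyFinite (undirectedComplement G)) where

    private
      neighbours : V → List V
      neighbours x = proj₁ (locallyFinite x)

      ∈-neighbours : ∀ {x y} → y ∈ NonAdj x → y List.∈ neighbours x
      ∈-neighbours {x} {y} = Equivalence.to (proj₂ (locallyFinite x) y)

    -- After one vertex `x` is chosen, only its complement neighbours remain undominated. They form
    -- a finite list, on which the greedy construction finishes.
    maximalIndependent : Σ (Pred V ℓ) λ A →
      Independent G A × (∀ y → y ∈ A ⊎ ∃[ a ] (a ∈ A × _─_ G a y))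
    maximalIndependent with em {Lift e V}
    -- Without vertices the empty set is maximal.
    ... | no  ¬V       = (λ _ → ⊥ₚ.⊥) , (λ ()) , λ y → contradiction (lift y) ¬V
    ... | yes (lift x) =
      B , insert-independent G indA (proj₂ ∘ A⊆) id , max′
      where
      rec  = finite-maximalIndependent (neighbours x) (NonAdj x)
      A    = proj₁ rec
      A⊆   = proj₁ (proj₂ rec)
      indA = proj₁ (proj₂ (proj₂ rec))
      max  = proj₂ (proj₂ (proj₂ rec))
      B : Pred V ℓ
      B y = y ≡ x ⊎ y ∈ A
      max′ : ∀ y → y ∈ B ⊎ ∃[ b ] (b ∈ B × _─_ G b y)
      max′ y with x ≟ y | E? x y | E? y x
      ... | yes refl | _      | _      = inj₁ (inj₁ refl)
      ... | no _     | yes xy | _      = inj₂ (x , inj₁ refl , inj₁ xy)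
      ... | no _     | no _   | yes yx = inj₂ (x , inj₁ refl , inj₂ yx)
      ... | no x≢y   | no ¬xy | no ¬yx
        with max (∈-neighbours (x≢y , ¬xy , ¬yx)) (x≢y , ¬xy , ¬yx)
      ...   | inj₁ y∈A            = inj₁ (inj₂ y∈A)
      ...   | inj₂ (a , a∈A , ay) = inj₂ (a , inj₂ a∈A , ay)

    private
      A : Pred V ℓ
      A = proj₁ maximalIndependent

      indA : Independent G A
      indA = proj₁ (proj₂ maximalIndependent)

      max : ∀ y → y ∈ A ⊎ ∃[ a ] (a ∈ A × _─_ G a y)
      max = proj₂ (proj₂ maximalIndependent)

      All : Pred V ℓ
      All _ = ⊤ₚ.⊤

    inOut-reached : (∀ y → Within₂ G All A y) → InOutClass 2 2 G
    inOut-reached reach =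
      -- `A` is a quasi-kernel of all of `G`, so the first part can be empty.
      (λ _ → ⊥ₚ.⊥) , All , ((λ _ → inj₂ _) , λ ()) ,
      inClass {A = λ _ → ⊥ₚ.⊥} (λ ()) (λ ()) (λ ()) , outClass _ indA (λ {y} _ → reach y)

    inOut-unreached : ∀ x → ¬ Within₂ G All A x → InOutClass 2 2 G
    inOut-unreached x ¬reach =
      ∁ W , W , (cover , λ (y∉W , y∈W) → y∉W y∈W) ,
      inClass A⊆∁W indA reach₁ , outClass B⊆W (insert-independent G indK nonadj id) reach₂
      where
      N⁺∖A : Pred V ℓ
      N⁺∖A y = y ∉ A × ∃[ a ] (a ∈ A × E a y)

      W : Pred V ℓ
      W y = y ≡ x ⊎ y ∈ N⁺∖A

      cover : Universal (∁ W ∪ W)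
      cover y with em {y ∈ W}
      ... | yes y∈W = inj₂ y∈W
      ... | no  y∉W = inj₁ y∉W

      A⊆∁W : A ⊆ ∁ W
      A⊆∁W a∈A (inj₁ refl)      = ¬reach (inj₁ a∈A)
      A⊆∁W a∈A (inj₂ (a∉A , _)) = a∉A a∈A

      reach₁ : ∀ {y} → y ∈ ∁ W → y ∈ A ⊎ ∃[ a ] (a ∈ A × E y a)
      reach₁ {y} y∉W with em {y ∈ A} | max y
      ... | yes y∈A | _                        = inj₁ y∈A
      ... | no y∉A  | inj₁ y∈A                 = inj₁ y∈A
      -- An out-neighbour of `A` outside `A` belongs to `W`, so only edges into `A` are left.
      ... | no y∉A  | inj₂ (a , a∈A , inj₁ ay) = contradiction (inj₂ (y∉A , a , a∈A , ay)) y∉W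
      ... | no y∉A  | inj₂ (a , a∈A , inj₂ ya) = inj₂ (a , a∈A , ya)

      -- The list of complement neighbours of `x` contains every vertex of `N⁺∖A ∩ NonAdj x`, so `K`
      -- reaches all of them.
      kernel = finite-quasiKernel (neighbours x) (N⁺∖A ∩ NonAdj x)
      K      = proj₁ kernel
      K⊆     = proj₁ (proj₂ kernel)
      indK   = proj₁ (proj₂ (proj₂ kernel))
      reachK = proj₂ (proj₂ (proj₂ kernel))

      nonadj : ∀ {y} → y ∈ K → ¬ E x y × ¬ E y x
      nonadj y∈K = proj₂ (proj₂ (K⊆ y∈K))

      B : Pred V ℓ
      B y = y ≡ x ⊎ y ∈ K

      B⊆W : B ⊆ W
      B⊆W (inj₁ y≡x) = inj₁ y≡x
      B⊆W (inj₂ y∈K) = inj₂ (proj₁ (K⊆ y∈K))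

      reach₂ : W ⊆ Within₂ G W B
      reach₂ (inj₁ y≡x) = inj₁ (inj₁ y≡x)
      reach₂ {y} (inj₂ y∈N@(_ , a , a∈A , ay)) with x ≟ y | E? x y | E? y x
      ... | yes refl | _      | _      = inj₁ (inj₁ refl)
      ... | no _     | yes xy | _      = inj₂ (inj₁ (x , inj₁ refl , xy))
      -- The walk through `a`, `y`, `x` would reach `x` from `A` in two steps.
      ... | no _     | no _   | yes yx =
        contradiction (inj₂ (inj₂ (a , y , a∈A , _ , ay , yx))) ¬reach
      ... | no x≢y   | no ¬xy | no ¬yx =
        let y∈NonAdj = x≢y , ¬xy , ¬yx
        in Within₂-mono G (inj₂ ∘ proj₁) inj₂ (reachK (∈-neighbours y∈NonAdj) (y∈N , y∈NonAdj))

    inOutClass : InOutClass 2 2 G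
    inOutClass with em {∃[ x ] ¬ Within₂ G All A x}
    ... | yes (x , ¬reach) = inOut-unreached x ¬reach
    ... | no  ∄unreached   = inOut-reached λ y → decidable-stable em λ ¬reach → ∄unreached (y , ¬reach)

theorem3p5 : ∀ {v e : Level} → ExcludedMiddle (v ⊔ e) →
    (G : Digraph v e) → LocallyFinite (undirectedComplement G) → InOutClass 2 2 G
theorem3p5 = inOutClass
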